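{- Let $\mathsf{Adj}_{=}$ be the category whose objects are posets and whose morphisms are Galois connections. The class $\mathsf{E}$ of reflections and the class $\mathsf{M}$ of coreflections form a factorization system $\langle \mathsf{E}, \mathsf{M} \rangle$ for $\mathsf{Adj}_{=}$. Moreover, the axis construction makes this a factorization system with choice: to each Galois connection $\mathbf{g} : \mathbf{A} \rightleftharpoons \mathbf{B}$ between posets it assigns the specified $\langle \mathsf{E}, \mathsf{M} \rangle$-factorization $\mathbf{g} = \mathsf{refl}(\mathbf{g}) \circ \mathsf{corefl}(\mathbf{g})$ through the poset $\diamondsuit(\mathbf{g})$, where $\mathsf{refl}(\mathbf{g}) : \mathbf{A} \rightleftharpoons \diamondsuit(\mathbf{g})$ is a reflection and $\mathsf{corefl}(\mathbf{g}) : \diamondsuit(\mathbf{g}) \rightleftharpoons \mathbf{B}$ is a coreflection.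
   Context: Galois connections. A Galois connection $\mathbf{g} = \langle \check{\mathbf{g}}, \hat{\mathbf{g}} \rangle : \mathbf{A} \rightleftharpoons \mathbf{B}$ from a poset $\mathbf{A} = \langle A, \leq_{\mathbf{A}}\rangle$ to a poset $\mathbf{B} = \langle B, \leq_{\mathbf{B}}\rangle$ is a pair of monotonic functions $\check{\mathbf{g}} : A \to B$ (left adjoint) and $\hat{\mathbf{g}} : B \to A$ (right adjoint) such that $\check{\mathbf{g}}(a) \leq_{\mathbf{B}} b$ if and only if $a \leq_{\mathbf{A}} \hat{\mathbf{g}}(b)$ for all $a \in A$, $b \in B$. Composition is written in diagrammatic order: for $\mathbf{g} : \mathbf{A} \rightleftharpoons \mathbf{B}$ and $\mathbf{h} : \mathbf{B} \rightleftharpoons \mathbf{C}$, the composite $\mathbf{g} \circ \mathbf{h} : \mathbf{A} \rightleftharpoons \mathbf{C}$ has left adjoint $a \mapsto \check{\mathbf{h}}(\check{\mathbf{g}}(a))$ and right adjoint $c \mapsto \hat{\mathbf{g}}(\hat{\mathbf{h}}(c))$. A reflection is a Galois connection with $\check{\mathbf{g}}(\hat{\mathbf{g}}(b)) = b$ for all $b \in B$; a coreflection is a Galois connection with $\hat{\mathbf{g}}(\check{\mathbf{g}}(a)) = a$ for all $a \in A$. Factorization systems. A factorization system in a category $\mathsf{C}$ is a pair $\langle \mathsf{E}, \mathsf{M} \rangle$ of classes of $\mathsf{C}$-morphisms such that: (Subcategories) all $\mathsf{C}$-isomorphisms are in $\mathsf{E} \cap \mathsf{M}$, and both $\mathsf{E}$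 and $\mathsf{M}$ are closed under composition; (Existence) every morphism $f : X \to Y$ has an $\langle \mathsf{E}, \mathsf{M} \rangle$-factorization, i.e. an object $Z$ and morphisms $e : X \to Z$ in $\mathsf{E}$ and $m : Z \to Y$ in $\mathsf{M}$ with $f = e \cdot m$ (diagrammatic order); (Uniqueness) any two $\langle \mathsf{E}, \mathsf{M} \rangle$-factorizations $(e, Z, m)$, $(e', Z', m')$ of the same $f$ are isomorphic: there is an isomorphism $h : Z \cong Z'$ with $e \cdot h = e'$ and $h \cdot m' = m$. A factorization system with choice has in addition a specified $\langle \mathsf{E}, \mathsf{M} \rangle$-factorization for each morphism. Axis construction. Let $\mathbf{g} : \mathbf{A} \rightleftharpoons \mathbf{B}$ be a Galois connection between posets. An element $a \in A$ is closed if $a = \hat{\mathbf{g}}(\check{\mathbf{g}}(a))$, and an element $b \in B$ is open if $b = \check{\mathbf{g}}(\hat{\mathbf{g}}(b))$. A bipole is a pair $(a,b)$ with $a \in A$ closed, $b \in B$ open and $a = \hat{\mathbf{g}}(b)$ (equivalently $b = \check{\mathbf{g}}(a)$). The axis $\diamondsuit(\mathbf{g})$ is the set of bipoles ordered by $(a_1,b_1) \leq (a_2,b_2)$ when $a_1 \leq_{\mathbf{A}} a_2$ (equivalently $b_1 \leq_{\mathbf{B}} b_2$). Let $\pi_0(a,b) = a$ and $\pi_1(a,b) = b$ be the projections, and define $\xi_0 : A \to \diamondsuit(\mathbf{g})$ by $\xi_0(a) = (\hat{\mathbf{g}}(\check{\mathbf{g}}(a)), \check{\mathbf{g}}(a))$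 and $\xi_1 : B \to \diamondsuit(\mathbf{g})$ by $\xi_1(b) = (\hat{\mathbf{g}}(b), \check{\mathbf{g}}(\hat{\mathbf{g}}(b)))$. Then $\mathsf{refl}(\mathbf{g}) = \langle \xi_0, \pi_0 \rangle : \mathbf{A} \rightleftharpoons \diamondsuit(\mathbf{g})$ and $\mathsf{corefl}(\mathbf{g}) = \langle \pi_1, \xi_1 \rangle : \diamondsuit(\mathbf{g}) \rightleftharpoons \mathbf{B}$ (left adjoint listed first). -}

module Defs where

open import Level using (Level; _⊔_) renaming (suc to lsuc)
open import Data.Product.Base using (Σ; _×_; _,_; proj₁; proj₂)
open import Relation.Binary.Core using (Rel)
open import Relation.Binary.Structures
  using (IsEquivalence; IsPreorder; IsPartialOrder)
open import Relation.Binary.Bundles using (Poset)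
open import Relation.Binary.Definitions using (Adjoint)
open import Relation.Binary.Morphism.Bundles
  using (PosetHomomorphism; mkPosetHomo)
open import Relation.Binary.Morphism.Construct.Composition
  using (posetHomomorphism)
open import Relation.Binary.Morphism.Construct.Identity
  using () renaming (posetHomomorphism to idPosetHomomorphism)

-- Hom-sets are setoids; composition is in diagrammatic order.

record Category (o h e : Level) : Set (lsuc (o ⊔ h ⊔ e)) where
  infix  4 _≈_
  infixl 9 _⨾_
  field
    Obj           : Set o
    Hom           : Obj → Obj → Set h
    _≈_           : ∀ {X Y} → Rel (Hom X Y) e
    isEquivalence : ∀ {X Y} → IsEquivalence (_≈_ {X} {Y})
    id            : ∀ X → Hom X X
    _⨾_           : ∀ {X Y Z} → Hom X Y → Hom Y Z → Hom X Z
    ⨾-cong        : ∀ {X Y Z} {f f′ : Hom X Y} {g g′ : Hom Y Z} →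
                    f ≈ f′ → g ≈ g′ → f ⨾ g ≈ f′ ⨾ g′
    identityˡ     : ∀ {X Y} (f : Hom X Y) → id X ⨾ f ≈ f
    identityʳ     : ∀ {X Y} (f : Hom X Y) → f ⨾ id Y ≈ f
    assoc         : ∀ {W X Y Z} (f : Hom W X) (g : Hom X Y) (h : Hom Y Z) →
                    (f ⨾ g) ⨾ h ≈ f ⨾ (g ⨾ h)

module _ {o h e : Level} (C : Category o h e) where
  open Category C

  record IsIso {X Y : Obj} (f : Hom X Y) : Set (h ⊔ e) where
    field
      inverse  : Hom Y X
      inverseʳ : f ⨾ inverse ≈ id X
      inverseˡ : inverse ⨾ f ≈ id Y

  -- A class of morphisms must not distinguish equal morphisms.

  record MorphismClass (p : Level) : Set (o ⊔ h ⊔ e ⊔ lsuc p) where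
    infix 4 _∋_
    field
      _∋_  : ∀ {X Y} → Hom X Y → Set p
      resp : ∀ {X Y} {f g : Hom X Y} → f ≈ g → _∋_ f → _∋_ g

  record Split (X Y : Obj) : Set (o ⊔ h) where
    constructor split
    field
      {mid} : Obj
      left  : Hom X mid
      right : Hom mid Y

  module _ {p q : Level} (E : MorphismClass p) (M : MorphismClass q) where
    private
      module E = MorphismClass E
      module M = MorphismClass M

    record IsFactorization {X Y : Obj} (f : Hom X Y) (s : Split X Y)
                           : Set (e ⊔ p ⊔ q) where
      open Split s
      field
        left∈E    : E._∋_ left
        right∈M   : M._∋_ right
        factorize : f ≈ left ⨾ right

    record IsFactorizationSystem : Set (o ⊔ h ⊔ e ⊔ p ⊔ q) where
      field
        iso∈E      : ∀ {X Y} (f : Hom X Y) → IsIso f → E._∋_ f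
        iso∈M      : ∀ {X Y} (f : Hom X Y) → IsIso f → M._∋_ f
        E-closed   : ∀ {X Y Z} (f : Hom X Y) (g : Hom Y Z) →
                     E._∋_ f → E._∋_ g → E._∋_ (f ⨾ g)
        M-closed   : ∀ {X Y Z} (f : Hom X Y) (g : Hom Y Z) →
                     M._∋_ f → M._∋_ g → M._∋_ (f ⨾ g)
        existence  : ∀ {X Y} (f : Hom X Y) →
                     Σ (Split X Y) λ s → IsFactorization f s
        uniqueness : ∀ {X Y} (f : Hom X Y) (s s′ : Split X Y) →
                     IsFactorization f s → IsFactorization f s′ →
                     Σ (Hom (Split.mid s) (Split.mid s′)) λ k →
                       IsIso k ×
                       (Split.left s ⨾ k ≈ Split.left s′) ×
                       (k ⨾ Split.right s′ ≈ Split.right s)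

    record IsFactorizationSystemWithChoice
             (choice : ∀ {X Y} → Hom X Y → Split X Y)
             : Set (o ⊔ h ⊔ e ⊔ p ⊔ q) where
      field
        isFactorizationSystem : IsFactorizationSystem
        isFactorization       : ∀ {X Y} (f : Hom X Y) →
                                IsFactorization f (choice f)

module _ {a a₁ a₂ b b₁ b₂ : Level}
         (A : Poset a a₁ a₂) (B : Poset b b₁ b₂) where
  private
    module A = Poset A
    module B = Poset B

  infix 1 _⇌_

  record _⇌_ : Set (a ⊔ a₁ ⊔ a₂ ⊔ b ⊔ b₁ ⊔ b₂) where
    field
      lower : PosetHomomorphism A B
      upper : PosetHomomorphism B A

    module ˇ = PosetHomomorphism lower
    module ˆ = PosetHomomorphism upper

    field
      adjoint : Adjoint A._≤_ B._≤_ ˇ.⟦_⟧ ˆ.⟦_⟧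

module _ {a a₁ a₂ b b₁ b₂ : Level}
         {A : Poset a a₁ a₂} {B : Poset b b₁ b₂} where
  private
    module A = Poset A
    module B = Poset B

  infixl 10 _ˇ_ _ˆ_
  infix  4 _≈ᴳ_

  _ˇ_ : A ⇌ B → A.Carrier → B.Carrier
  g ˇ x = _⇌_.ˇ.⟦_⟧ g x

  _ˆ_ : A ⇌ B → B.Carrier → A.Carrier
  g ˆ y = _⇌_.ˆ.⟦_⟧ g y

  record _≈ᴳ_ (g h : A ⇌ B) : Set (a ⊔ a₁ ⊔ b ⊔ b₁) where
    field
      lower-≈ : ∀ x → g ˇ x B.≈ h ˇ x
      upper-≈ : ∀ y → g ˆ y A.≈ h ˆ y

  open _≈ᴳ_

  IsReflection : A ⇌ B → Set (b ⊔ b₁)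
  IsReflection g = ∀ y → g ˇ (g ˆ y) B.≈ y

  IsCoreflection : A ⇌ B → Set (a ⊔ a₁)
  IsCoreflection g = ∀ x → g ˆ (g ˇ x) A.≈ x

  ≈ᴳ-isEquivalence : IsEquivalence _≈ᴳ_
  ≈ᴳ-isEquivalence = record
    { refl  = record { lower-≈ = λ _ → B.Eq.refl ; upper-≈ = λ _ → A.Eq.refl }
    ; sym   = λ p → record
      { lower-≈ = λ x → B.Eq.sym (lower-≈ p x)
      ; upper-≈ = λ y → A.Eq.sym (upper-≈ p y)
      }
    ; trans = λ p q → record
      { lower-≈ = λ x → B.Eq.trans (lower-≈ p x) (lower-≈ q x)
      ; upper-≈ = λ y → A.Eq.trans (upper-≈ p y) (upper-≈ q y)
      }
    }

open _≈ᴳ_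

idᴳ : ∀ {a a₁ a₂} (A : Poset a a₁ a₂) → A ⇌ A
idᴳ A = record
  { lower   = idPosetHomomorphism A
  ; upper   = idPosetHomomorphism A
  ; adjoint = (λ p → p) , (λ p → p)
  }

infixl 9 _∘ᴳ_

_∘ᴳ_ : ∀ {a a₁ a₂ b b₁ b₂ c c₁ c₂}
       {A : Poset a a₁ a₂} {B : Poset b b₁ b₂} {C : Poset c c₁ c₂} →
       A ⇌ B → B ⇌ C → A ⇌ C
g ∘ᴳ h = record
  { lower   = posetHomomorphism (_⇌_.lower g) (_⇌_.lower h)
  ; upper   = posetHomomorphism (_⇌_.upper h) (_⇌_.upper g)
  ; adjoint = (λ p → proj₁ (_⇌_.adjoint g) (proj₁ (_⇌_.adjoint h) p))
            , (λ p → proj₂ (_⇌_.adjoint h) (proj₂ (_⇌_.adjoint g) p))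
  }

-- The carrier level absorbs that of the equality, since bipoles carry
-- equality proofs and the axis must again be an object.

Adj₌ : (c ℓ₁ ℓ₂ : Level) →
       Category (lsuc (c ⊔ ℓ₁ ⊔ ℓ₂)) (c ⊔ ℓ₁ ⊔ ℓ₂) (c ⊔ ℓ₁)
Adj₌ c ℓ₁ ℓ₂ = record
  { Obj           = Poset (c ⊔ ℓ₁) ℓ₁ ℓ₂
  ; Hom           = _⇌_
  ; _≈_           = _≈ᴳ_
  ; isEquivalence = ≈ᴳ-isEquivalence
  ; id            = idᴳ
  ; _⨾_           = _∘ᴳ_
  ; ⨾-cong        = λ {X} {Y} {Z} {f} {f′} {g} {g′} p q → record
      { lower-≈ = λ x → Poset.Eq.trans Z (_⇌_.ˇ.cong g (lower-≈ p x)) (lower-≈ q _)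
      ; upper-≈ = λ z → Poset.Eq.trans X (_⇌_.ˆ.cong f (upper-≈ q z)) (upper-≈ p _)
      }
  ; identityˡ     = λ _ → IsEquivalence.refl ≈ᴳ-isEquivalence
  ; identityʳ     = λ _ → IsEquivalence.refl ≈ᴳ-isEquivalence
  ; assoc         = λ {W} {X} {Y} {Z} _ _ _ → record
      { lower-≈ = λ _ → Poset.Eq.refl Z
      ; upper-≈ = λ _ → Poset.Eq.refl W
      }
  }

Reflections : (c ℓ₁ ℓ₂ : Level) → MorphismClass (Adj₌ c ℓ₁ ℓ₂) (c ⊔ ℓ₁)
Reflections c ℓ₁ ℓ₂ = record
  { _∋_  = IsReflection
  ; resp = λ {X} {Y} {f} {g} p r y →
      Poset.Eq.trans Y (Poset.Eq.sym Y (lower-≈ p _))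
        (Poset.Eq.trans Y (_⇌_.ˇ.cong f (Poset.Eq.sym X (upper-≈ p y))) (r y))
  }

Coreflections : (c ℓ₁ ℓ₂ : Level) → MorphismClass (Adj₌ c ℓ₁ ℓ₂) (c ⊔ ℓ₁)
Coreflections c ℓ₁ ℓ₂ = record
  { _∋_  = IsCoreflection
  ; resp = λ {X} {Y} {f} {g} p r x →
      Poset.Eq.trans X (Poset.Eq.sym X (upper-≈ p _))
        (Poset.Eq.trans X (_⇌_.ˆ.cong f (Poset.Eq.sym Y (lower-≈ p x))) (r x))
  }

module _ {a a₁ a₂ b b₁ b₂ : Level}
         {A : Poset a a₁ a₂} {B : Poset b b₁ b₂} (g : A ⇌ B) where
  private
    module A = Poset A
    module B = Poset B
    module g = _⇌_ g

  Closed : A.Carrier → Set a₁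
  Closed x = x A.≈ g ˆ (g ˇ x)

  Open : B.Carrier → Set b₁
  Open y = y B.≈ g ˇ (g ˆ y)

  record Bipole : Set (a ⊔ a₁ ⊔ b ⊔ b₁) where
    field
      π₀     : A.Carrier
      π₁     : B.Carrier
      closed : Closed π₀
      opened : Open π₁
      polar  : π₀ A.≈ g ˆ π₁

  open Bipole

  private
    unit : ∀ x → x A.≤ g ˆ (g ˇ x)
    unit _ = proj₁ g.adjoint B.refl

    counit : ∀ y → g ˇ (g ˆ y) B.≤ y
    counit _ = proj₂ g.adjoint A.refl

    triangleˇ : ∀ x → g ˇ x B.≈ g ˇ (g ˆ (g ˇ x))
    triangleˇ x = B.antisym (g.ˇ.mono (unit x)) (counit _)

    triangleˆ : ∀ y → g ˆ y A.≈ g ˆ (g ˇ (g ˆ y))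
    triangleˆ y = A.antisym (unit _) (g.ˆ.mono (counit y))

    polar′ : ∀ p → π₁ p B.≈ g ˇ π₀ p
    polar′ p = B.Eq.trans (opened p) (g.ˇ.cong (A.Eq.sym (polar p)))

    π₁-mono : ∀ {p q} → π₀ p A.≤ π₀ q → π₁ p B.≤ π₁ q
    π₁-mono {p} {q} le =
      B.trans (B.reflexive (polar′ p))
        (B.trans (g.ˇ.mono le) (B.reflexive (B.Eq.sym (polar′ q))))

  -- Equality of bipoles ignores the proofs they carry.

  ◇ : Poset (a ⊔ a₁ ⊔ b ⊔ b₁) (a₁ ⊔ b₁) a₂
  ◇ = record
    { Carrier        = Bipole
    ; _≈_            = λ p q → (π₀ p A.≈ π₀ q) × (π₁ p B.≈ π₁ q)
    ; _≤_            = λ p q → π₀ p A.≤ π₀ q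
    ; isPartialOrder = record
      { isPreorder = record
        { isEquivalence = record
          { refl  = A.Eq.refl , B.Eq.refl
          ; sym   = λ (u , v) → A.Eq.sym u , B.Eq.sym v
          ; trans = λ (u , v) (u′ , v′) → A.Eq.trans u u′ , B.Eq.trans v v′
          }
        ; reflexive = λ (u , _) → A.reflexive u
        ; trans     = A.trans
        }
      ; antisym = λ {p} {q} u v →
          A.antisym u v , B.antisym (π₁-mono {p} {q} u) (π₁-mono {q} {p} v)
      }
    }

  ξ₀ : A.Carrier → Bipole
  ξ₀ x = record
    { π₀     = g ˆ (g ˇ x)
    ; π₁     = g ˇ x
    ; closed = triangleˆ (g ˇ x)
    ; opened = triangleˇ x
    ; polar  = A.Eq.refl
    }

  ξ₁ : B.Carrier → Bipole
  ξ₁ y = record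
    { π₀     = g ˆ y
    ; π₁     = g ˇ (g ˆ y)
    ; closed = triangleˆ y
    ; opened = triangleˇ (g ˆ y)
    ; polar  = triangleˆ y
    }

  axis-refl : A ⇌ ◇
  axis-refl = record
    { lower   = mkPosetHomo A ◇ ξ₀ (λ le → g.ˆ.mono (g.ˇ.mono le))
    ; upper   = mkPosetHomo ◇ A π₀ (λ le → le)
    ; adjoint = λ {x} {p} →
        (λ le → A.trans (unit x) le)
      , (λ le → A.trans (g.ˆ.mono (g.ˇ.mono le))
                        (A.reflexive (A.Eq.sym (closed p))))
    }

  axis-corefl : ◇ ⇌ B
  axis-corefl = record
    { lower   = mkPosetHomo ◇ B π₁ (λ {p} {q} → π₁-mono {p} {q})
    ; upper   = mkPosetHomo B ◇ ξ₁ g.ˆ.mono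
    ; adjoint = λ {p} {y} →
        (λ le → A.trans (A.reflexive (polar p)) (g.ˆ.mono le))
      , (λ le → B.trans (B.reflexive (polar′ p)) (proj₂ g.adjoint le))
    }

axis-split : (c ℓ₁ ℓ₂ : Level) {A B : Poset (c ⊔ ℓ₁) ℓ₁ ℓ₂} →
             A ⇌ B → Split (Adj₌ c ℓ₁ ℓ₂) A B
axis-split c ℓ₁ ℓ₂ g = split {mid = ◇ g} (axis-refl g) (axis-corefl g)

{-# OPTIONS --safe #-}

-- The left adjoint of a coreflection reflects the order.  Hence in any
-- factorization f = e ⨾ m into a reflection and a coreflection, e ˇ x ≤ e ˇ y
-- holds exactly when f ˇ x ≤ f ˇ y, so e is determined up to isomorphism as the
-- quotient of its source by the preorder that f induces; the comparison between
-- two factorizations sends z to e′ ˇ (e ˆ z).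

module Submission where

open import Defs
open import Level using (Level)
open import Data.Product.Base using (_,_; proj₁; proj₂)
open import Relation.Binary.Bundles using (Poset)
open import Relation.Binary.Structures using (IsEquivalence)
open import Relation.Binary.Morphism.Bundles using (mkPosetHomo)
import Relation.Binary.Reasoning.PartialOrder as ≤-Reasoning

private
  variable
    a a₁ a₂ b b₁ b₂ c c₁ c₂ : Level

module _ {A : Poset a a₁ a₂} {B : Poset b b₁ b₂} (g : A ⇌ B) where
  private
    module A = Poset A
    module B = Poset B
    module g = _⇌_ g

  unit : ∀ x → x A.≤ g ˆ (g ˇ x)
  unit _ = proj₁ g.adjoint B.refl

  counit : ∀ y → g ˇ (g ˆ y) B.≤ y
  counit _ = proj₂ g.adjoint A.refl

  ˇ-triangle : ∀ x → g ˇ (g ˆ (g ˇ x)) B.≈ g ˇ x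
  ˇ-triangle x = B.antisym (counit _) (g.ˇ.mono (unit x))

  ˆ-triangle : ∀ y → g ˆ (g ˇ (g ˆ y)) A.≈ g ˆ y
  ˆ-triangle y = A.antisym (g.ˆ.mono (counit y)) (unit _)

  coreflection-ˇ-cancel-≤ : IsCoreflection g →
                            ∀ {x y} → g ˇ x B.≤ g ˇ y → x A.≤ y
  coreflection-ˇ-cancel-≤ cor le =
    A.trans (proj₁ g.adjoint le) (A.reflexive (cor _))

  -- A section puts every `y` in the image of `g ˇ`, and on that image the triangle identity makes
  -- `g ˇ (g ˆ _)` the identity.
  split-epiˇ⇒reflection : (s : B.Carrier → A.Carrier) →
                          (∀ y → g ˇ s y B.≈ y) → IsReflection g
  split-epiˇ⇒reflection s gs≈id y =
    B.Eq.trans (g.ˇ.cong (g.ˆ.cong (B.Eq.sym (gs≈id y))))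
      (B.Eq.trans (ˇ-triangle (s y)) (gs≈id y))

  split-epiˆ⇒coreflection : (s : A.Carrier → B.Carrier) →
                            (∀ x → g ˆ s x A.≈ x) → IsCoreflection g
  split-epiˆ⇒coreflection s gs≈id x =
    A.Eq.trans (g.ˆ.cong (g.ˇ.cong (A.Eq.sym (gs≈id x))))
      (A.Eq.trans (ˆ-triangle (s x)) (gs≈id x))

module _ {A : Poset a a₁ a₂} {B : Poset b b₁ b₂} where
  private
    module A = Poset A
    module B = Poset B

  ˇ-≈⇒ˆ-≤ : (g h : A ⇌ B) → (∀ x → g ˇ x B.≈ h ˇ x) →
            ∀ y → g ˆ y A.≤ h ˆ y
  ˇ-≈⇒ˆ-≤ g h eq y = proj₁ (_⇌_.adjoint h)
    (B.trans (B.reflexive (B.Eq.sym (eq _))) (counit g y))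

  -- A left adjoint determines its right adjoint: transposing the counit of one connection along the
  -- other compares the right adjoints both ways, and antisymmetry concludes.
  ˇ-≈⇒≈ᴳ : (g h : A ⇌ B) → (∀ x → g ˇ x B.≈ h ˇ x) → g ≈ᴳ h
  ˇ-≈⇒≈ᴳ g h eq = record
    { lower-≈ = eq
    ; upper-≈ = λ y → A.antisym (ˇ-≈⇒ˆ-≤ g h eq y)
                                (ˇ-≈⇒ˆ-≤ h g (λ x → B.Eq.sym (eq x)) y)
    }

module _ {A : Poset a a₁ a₂} {B : Poset b b₁ b₂} {C : Poset c c₁ c₂}
         (g : A ⇌ B) (h : B ⇌ C) where

  ∘ᴳ-reflection : IsReflection g → IsReflection h → IsReflection (g ∘ᴳ h)
  ∘ᴳ-reflection r s z =
    Poset.Eq.trans C (_⇌_.ˇ.cong h (r _)) (s z)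

  ∘ᴳ-coreflection : IsCoreflection g → IsCoreflection h →
                    IsCoreflection (g ∘ᴳ h)
  ∘ᴳ-coreflection r s x =
    Poset.Eq.trans A (_⇌_.ˆ.cong g (s _)) (r x)

module _ {A : Poset a a₁ a₂} {B : Poset b b₁ b₂} (g : A ⇌ B) where
  private
    module A = Poset A
    module B = Poset B
    module g = _⇌_ g

  axis-refl-reflection : IsReflection (axis-refl g)
  axis-refl-reflection p =
      A.Eq.sym closed
    , B.Eq.trans (g.ˇ.cong polar) (B.Eq.sym opened)
    where open Bipole p

  axis-corefl-coreflection : IsCoreflection (axis-corefl g)
  axis-corefl-coreflection p = A.Eq.sym polar , B.Eq.sym opened
    where open Bipole p

  axis-factorize : g ≈ᴳ axis-refl g ∘ᴳ axis-corefl g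
  axis-factorize = record
    -- The composites `π₁ (ξ₀ x)` and `π₀ (ξ₁ y)` reduce to `g ˇ x` and `g ˆ y`.
    { lower-≈ = λ _ → B.Eq.refl
    ; upper-≈ = λ _ → A.Eq.refl
    }

module _ {d d₁ d₂ : Level}
         {A : Poset a a₁ a₂} {B : Poset b b₁ b₂}
         {Z : Poset c c₁ c₂} {Z′ : Poset d d₁ d₂}
         (e : A ⇌ Z) (m : Z ⇌ B) (e′ : A ⇌ Z′) (m′ : Z′ ⇌ B)
         (same : e ∘ᴳ m ≈ᴳ e′ ∘ᴳ m′) (cor′ : IsCoreflection m′) where
  private
    module Z = Poset Z
    module Z′ = Poset Z′
    module m = _⇌_ m
    open _≈ᴳ_ same

  -- `m` pushes the inequality into `B`, where the two composites agree, and the coreflection `m′`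
  -- reflects it back into `Z′`.
  transfer-≤ : ∀ {x y} → e ˇ x Z.≤ e ˇ y → e′ ˇ x Z′.≤ e′ ˇ y
  transfer-≤ {x} {y} le = coreflection-ˇ-cancel-≤ m′ cor′ (begin
    m′ ˇ (e′ ˇ x)  ≈⟨ lower-≈ x ⟨
    m ˇ (e ˇ x)    ≤⟨ m.ˇ.mono le ⟩
    m ˇ (e ˇ y)    ≈⟨ lower-≈ y ⟩
    m′ ˇ (e′ ˇ y)  ∎)
    where open ≤-Reasoning B

  transfer-≈ : ∀ {x y} → e ˇ x Z.≈ e ˇ y → e′ ˇ x Z′.≈ e′ ˇ y
  transfer-≈ eq = Z′.antisym (transfer-≤ (Z.reflexive eq))
                             (transfer-≤ (Z.reflexive (Z.Eq.sym eq)))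

module Comparison
  {d d₁ d₂ : Level}
  {A : Poset a a₁ a₂} {B : Poset b b₁ b₂}
  {Z : Poset c c₁ c₂} {Z′ : Poset d d₁ d₂}
  (e : A ⇌ Z) (m : Z ⇌ B) (e′ : A ⇌ Z′) (m′ : Z′ ⇌ B)
  (same : e ∘ᴳ m ≈ᴳ e′ ∘ᴳ m′) (same′ : e′ ∘ᴳ m′ ≈ᴳ e ∘ᴳ m)
  (ref : IsReflection e) (cor : IsCoreflection m)
  (ref′ : IsReflection e′) (cor′ : IsCoreflection m′) where
  private
    module B = Poset B
    module Z = Poset Z
    module Z′ = Poset Z′
    module e = _⇌_ e
    module m = _⇌_ m
    module e′ = _⇌_ e′
    open _≈ᴳ_ same

  comparison : Z ⇌ Z′
  comparison = record
    { lower   = mkPosetHomo Z Z′ (λ z → e′ ˇ (e ˆ z))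
                  (λ le → e′.ˇ.mono (e.ˆ.mono le))
    ; upper   = mkPosetHomo Z′ Z (λ z′ → e ˇ (e′ ˆ z′))
                  (λ le → e.ˇ.mono (e′.ˆ.mono le))
    -- The reflection laws rewrite `z` as `e ˇ (e ˆ z)` and `z′` as `e′ ˇ (e′ ˆ z′)`, so that both
    -- sides lie in images to which `transfer-≤` applies.
    ; adjoint = λ {z} {z′} →
        (λ le → Z.trans (Z.reflexive (Z.Eq.sym (ref z)))
          (transfer-≤ e′ m′ e m same′ cor
            (Z′.trans le (Z′.reflexive (Z′.Eq.sym (ref′ z′))))))
      , (λ le → Z′.trans
          (transfer-≤ e m e′ m′ same cor′
            (Z.trans (Z.reflexive (ref z)) le))
          (Z′.reflexive (ref′ z′)))
    }

  -- `e′ ˇ` identifies `e′ ˆ (e′ ˇ (e ˆ z))` with `e ˆ z`, hence so does `e ˇ`, and `e` is a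
  -- reflection.
  comparison-inverse : ∀ z → e ˇ (e′ ˆ (e′ ˇ (e ˆ z))) Z.≈ z
  comparison-inverse z = Z.Eq.trans
    (transfer-≈ e′ m′ e m same′ cor (ˇ-triangle e′ (e ˆ z))) (ref z)

  -- `e ˇ` takes the same value at `e ˆ (e ˇ x)` and `x`, hence so does `e′ ˇ`.
  left-comparison : e ∘ᴳ comparison ≈ᴳ e′
  left-comparison = ˇ-≈⇒≈ᴳ (e ∘ᴳ comparison) e′ λ x →
    transfer-≈ e m e′ m′ same cor′ (ˇ-triangle e x)

  comparison-right : comparison ∘ᴳ m′ ≈ᴳ m
  comparison-right = ˇ-≈⇒≈ᴳ (comparison ∘ᴳ m′) m λ z →
    B.Eq.trans (B.Eq.sym (lower-≈ (e ˆ z))) (m.ˇ.cong (ref z))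

theorem2 : (c ℓ₁ ℓ₂ : Level) →
    IsFactorizationSystemWithChoice (Adj₌ c ℓ₁ ℓ₂)
    (Reflections c ℓ₁ ℓ₂) (Coreflections c ℓ₁ ℓ₂)
    (axis-split c ℓ₁ ℓ₂)
theorem2 c ℓ₁ ℓ₂ = record
  { isFactorizationSystem = record
    -- The left adjoint of the inverse is a section of `f ˇ`; dually, its right adjoint is a section
    -- of `f ˆ`.
    { iso∈E      = λ f i → split-epiˇ⇒reflection f
                     (IsIso.inverse i ˇ_) (_≈ᴳ_.lower-≈ (IsIso.inverseˡ i))
    ; iso∈M      = λ f i → split-epiˆ⇒coreflection f
                     (IsIso.inverse i ˆ_) (_≈ᴳ_.upper-≈ (IsIso.inverseʳ i))
    ; E-closed   = ∘ᴳ-reflection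
    ; M-closed   = ∘ᴳ-coreflection
    ; existence  = λ f → axis-split c ℓ₁ ℓ₂ f , axis-isFactorization f
    ; uniqueness = unique
    }
  ; isFactorization = axis-isFactorization
  }
  where
  C = Adj₌ c ℓ₁ ℓ₂
  E = Reflections c ℓ₁ ℓ₂
  M = Coreflections c ℓ₁ ℓ₂

  axis-isFactorization : ∀ {X Y} (f : Category.Hom C X Y) →
                         IsFactorization C E M f (axis-split c ℓ₁ ℓ₂ f)
  axis-isFactorization f = record
    { left∈E    = axis-refl-reflection f
    ; right∈M   = axis-corefl-coreflection f
    ; factorize = axis-factorize f
    }

  unique : ∀ {X Y} (f : Category.Hom C X Y) (s s′ : Split C X Y) → _
  unique f (split e m) (split e′ m′) φ φ′ =
      K.comparison
    , record
      { inverse  = K⁻¹.comparison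
      -- `K` and `K⁻¹` have the same two maps with left and right adjoint interchanged, so both
      -- components of each round trip are the same map.
      ; inverseʳ = record { lower-≈ = K.comparison-inverse
                          ; upper-≈ = K.comparison-inverse }
      ; inverseˡ = record { lower-≈ = K⁻¹.comparison-inverse
                          ; upper-≈ = K⁻¹.comparison-inverse }
      }
    , K.left-comparison
    , K.comparison-right
    where
    module φ  = IsFactorization φ
    module φ′ = IsFactorization φ′
    same : e ∘ᴳ m ≈ᴳ e′ ∘ᴳ m′
    same = IsEquivalence.trans ≈ᴳ-isEquivalence
             (IsEquivalence.sym ≈ᴳ-isEquivalence φ.factorize) φ′.factorize
    same′ : e′ ∘ᴳ m′ ≈ᴳ e ∘ᴳ m
    same′ = IsEquivalence.sym ≈ᴳ-isEquivalence same
    module K   = Comparison e m e′ m′ same same′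
                   φ.left∈E φ.right∈M φ′.left∈E φ′.right∈M
    module K⁻¹ = Comparison e′ m′ e m same′ same
                   φ′.left∈E φ′.right∈M φ.left∈E φ.right∈M
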